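{- Let $\mathcal{R}$ be the set of rules of an LCTRS, let $\mathcal{P}$ be a DP problem (a set of dependency pairs), and let $G$ be a dependency graph approximation of $\mathcal{P}$. Then $\mathcal{P}$ is chain-free if and only if $\mathcal{P}'$ is chain-free for every strongly connected component (SCC) $\mathcal{P}'$ of $G$.
   Context: Terms are many-sorted. Let $\mathcal{V}$ be an infinite set of sorted variables; let $\Sigma=\Sigma_{\mathit{terms}}\cup\Sigma_{\mathit{theory}}$ be a many-sorted signature; let $\mathcal{I}$ assign to each sort $\iota$ occurring in $\Sigma_{\mathit{theory}}$ a set $\mathcal{I}_\iota$; let $\mathcal{J}$ map each $f:[\iota_1\times\cdots\times\iota_n]\Rightarrow\kappa$ in $\Sigma_{\mathit{theory}}$ to a function $\mathcal{J}_f$ from $\mathcal{I}_{\iota_1},\ldots,\mathcal{I}_{\iota_n}$ to $\mathcal{I}_\kappa$. For each sort $\iota$ occurring in $\Sigma_{\mathit{theory}}$ fix a set $\mathcal{V}al_\iota\subseteq\Sigma_{\mathit{theory}}$ of values: constants of sort $\iota$ such that $\mathcal{J}$ gives a one-to-one mapping from $\mathcal{V}al_\iota$ to $\mathcal{I}_\iota$ (every element of $\mathcal{I}_\iota$ is represented by a unique value); $\mathcal{V}al$ is the set of all values. $\Sigma_{\mathit{terms}}$ and $\Sigma_{\mathit{theory}}$ overlap only on values. $\mathcal{T}\mathit{erms}(\Sigma',X)$ is the set of well-sorted terms over symbols $\Sigma'$ and variables $X$; $\mathit{Var}(s)$ is the set of variables of $s$. A logical term is an element of $\mathcal{T}\mathit{erms}(\Sigma_{\mathit{theory}},\mathcal{V})$.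 For ground logical terms, $[\![f(s_1,\ldots,s_n)]\!]:=\mathcal{J}_f([\![s_1]\!],\ldots,[\![s_n]\!])$; the value of a ground logical term $s$ is the unique value $t$ with $[\![s]\!]=[\![t]\!]$. A constraint is a logical term of a sort $\mathsf{bool}$ with $\mathcal{I}_{\mathsf{bool}}=\{\top,\bot\}$ (the booleans). A constraint $s$ is valid if $[\![s\gamma]\!]=\top$ for all substitutions $\gamma$ mapping the variables in $\mathit{Var}(s)$ to values. A rule is a triple $l\to r\,[\varphi]$ where $l,r$ are terms of the same sort, $\varphi$ is a constraint, and $l$ is not a logical term (so also not a variable). $\mathit{LVar}(l\to r\,[\varphi]):=\mathit{Var}(\varphi)\cup(\mathit{Var}(r)\setminus\mathit{Var}(l))$. A substitution $\gamma$ respects $l\to r\,[\varphi]$ if $\gamma(x)$ is a value for all $x\in\mathit{LVar}(l\to r\,[\varphi])$ and $\varphi\gamma$ is valid. An LCTRS is given by such a setting with a set $\mathcal{R}$ of rules; $\to_{\mathcal{R}}$ is the union of $\to_{\mathtt{rule}}$ and $\to_{\mathtt{calc}}$, where $C[l\gamma]\to_{\mathtt{rule}}C[r\gamma]$ if $l\to r\,[\varphi]\in\mathcal{R}$ and $\gamma$ respects $l\to r\,[\varphi]$; and $C[f(s_1,\ldots,s_n)]\to_{\mathtt{calc}}C[v]$ if $f\in\Sigma_{\mathit{theory}}\setminus\Sigma_{\mathit{terms}}$, all $s_i$ are values and $v$ is the value of $f(s_1,\ldots,s_n)$. Defined symbols are all symbols $f$ such that $\mathcal{R}$ contains a rule of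 the form $f(\vec{l})\to r\,[\varphi]$. Dependency pairs: introduce a fresh sort $\mathsf{dpsort}$ and, for each defined symbol $f:[\iota_1\times\cdots\times\iota_n]\Rightarrow\kappa$, a new symbol $f^\sharp:[\iota_1\times\cdots\times\iota_n]\Rightarrow\mathsf{dpsort}$. If $s=f(s_1,\ldots,s_n)$ with $f$ defined, then $s^\sharp:=f^\sharp(s_1,\ldots,s_n)$. The dependency pairs of a rule $l\to r\,[\varphi]$ are all rules $l^\sharp\to p^\sharp\,[\varphi]$ where $p$ is a subterm of $r$ headed by a defined symbol. The set $\mathcal{R}$ of rules is fixed. Given a set $\mathcal{P}$ of dependency pairs (called a DP problem), a $\mathcal{P}$-chain is a sequence $\rho_1,\rho_2,\ldots$ of elements of $\mathcal{P}$, each with distinctly renamed variables, such that there is a substitution $\gamma$ which respects all $\rho_i$ and such that for all $i$: if $\rho_i=l_i\to p_i\,[\varphi_i]$ and $\rho_{i+1}=l_{i+1}\to p_{i+1}\,[\varphi_{i+1}]$, then $p_i\gamma\to_{\mathcal{R}}^* l_{i+1}\gamma$; moreover the strict subterms of each $l_i\gamma$ are terminating with respect to $\to_{\mathcal{R}}$. (The single substitution $\gamma$ may have infinite domain.) $\mathcal{P}$ is chain-free if there is no infinite $\mathcal{P}$-chain. A dependency graph approximation of a DP problem $\mathcal{P}$ is a (directed) graph $G$ whose nodes are the elements of $\mathcal{P}$ and which has an edge from $\rho_1$ to $\rho_2$ whenever $(\rho_1,\rho_2')$ is a $\mathcal{P}$-chain, where $\rho_2'$ is a copy of $\rho_2$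 with fresh variables. $G$ may have additional edges.
   Formalization: The DP problem P is assumed finite; for infinite P the claim fails, e.g. rules f_i → f_{i+1} (i ∈ ℕ), where P has an infinite chain but every SCC of the exact graph is a loop-free, chain-free singleton. -}

module Defs where

open import Data.Bool.Base using (Bool; true)
open import Data.Empty using (⊥)
open import Data.Fin.Base using (Fin; toℕ)
open import Data.List.Base using (List; []; _∷_; map)
open import Data.List.Membership.Propositional using (_∈_)
open import Data.List.Membership.Propositional.Properties using (∈-map⁺; ∈-map⁻)
open import Data.List.Relation.Unary.All using (All; []; _∷_; lookup)
open import Data.List.Relation.Unary.All.Properties using (map⁻)
open import Data.Nat.Base using (ℕ; zero; suc)
open import Data.Product using (∃; ∃!; Σ-syntax; ∃-syntax; _×_; _,_)
open import Data.Sum.Base using (_⊎_; inj₁; inj₂)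
open import Data.Unit.Base using (⊤)
import Data.Vec.Functional as Seq
open import Function.Base using (id; _∘_)
open import Function.Bundles using (_↔_; _↣_; Inverse; Injection; mk↣)
open import Level using (0ℓ)
open import Relation.Binary.Construct.Closure.ReflexiveTransitive using (Star)
open import Relation.Binary.Core using (Rel)
open import Relation.Binary.PropositionalEquality.Core using (_≡_; _≢_; refl; cong)
open import Relation.Nullary.Negation.Core using (¬_)
open import Relation.Unary using (Pred; _⊆_; Satisfiable)

data OccursIn {Sort : Set} {Fun : List Sort → Sort → Set}
              (Q : ∀ {ιs κ} → Fun ιs κ → Set) : Sort → Set where
  output : ∀ {ιs κ} {f : Fun ιs κ} → Q f → OccursIn Q κ
  input  : ∀ {ιs κ ι} {f : Fun ιs κ} → Q f → ι ∈ ιs → OccursIn Q ι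

record Setting : Set₁ where
  field
    Sort : Set
    Var  : Sort → Set
    Fun  : List Sort → Sort → Set

    Var-infinite : ℕ ↣ ∃ Var

    IsTerms IsTheory IsValue : ∀ {ιs κ} → Fun ιs κ → Set

    terms∪theory   : ∀ {ιs κ} (f : Fun ιs κ) → IsTerms f ⊎ IsTheory f
    terms∩theory   : ∀ {ιs κ} {f : Fun ιs κ} → IsTerms f → IsTheory f → IsValue f
    value-constant : ∀ {ιs κ} {f : Fun ιs κ} → IsValue f → ιs ≡ []
    value⇒theory   : ∀ {ιs κ} {f : Fun ιs κ} → IsValue f → IsTheory f

    -- ℐ matters only at the sorts occurring in Σ_theory; it is a dummy
    -- elsewhere.
    ℐ : Sort → Set
    𝒥 : ∀ {ιs κ} (f : Fun ιs κ) → .(IsTheory f) → All ℐ ιs → ℐ κ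

    value-unique : ∀ {ι} → OccursIn {Fun = Fun} IsTheory ι → (a : ℐ ι) →
      ∃! _≡_ λ (v : Fun [] ι) → Σ[ p ∈ IsValue v ] 𝒥 v (value⇒theory p) [] ≡ a

    bool        : Sort
    bool-theory : OccursIn {Fun = Fun} IsTheory bool
    ℐ-bool      : ℐ bool ↔ Bool

module Terms (S : Setting) where
  open Setting S

  data Term : Sort → Set where
    var : ∀ {ι} → Var ι → Term ι
    fun : ∀ {ιs κ} → Fun ιs κ → All Term ιs → Term κ

  data _∈Var_ {ι} (x : Var ι) : ∀ {κ} → Term κ → Set where
    here  : x ∈Var var x
    there : ∀ {ιs κ ι′} {f : Fun ιs κ} {ts : All Term ιs} (i : ι′ ∈ ιs) →
            x ∈Var lookup ts i → x ∈Var fun f ts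

  data _⊴_ {ι} (s : Term ι) : ∀ {κ} → Term κ → Set where
    self : s ⊴ s
    arg  : ∀ {ιs κ ι′} {f : Fun ιs κ} {ts : All Term ιs} (i : ι′ ∈ ιs) →
           s ⊴ lookup ts i → s ⊴ fun f ts

  data _◁_ {ι} (s : Term ι) : ∀ {κ} → Term κ → Set where
    arg : ∀ {ιs κ ι′} {f : Fun ιs κ} {ts : All Term ιs} (i : ι′ ∈ ιs) →
          s ⊴ lookup ts i → s ◁ fun f ts

  Subst : Set
  Subst = ∀ ι → Var ι → Term ι

  _[_]  : ∀ {κ} → Term κ → Subst → Term κ
  _[_]* : ∀ {ιs} → All Term ιs → Subst → All Term ιs
  var x    [ γ ] = γ _ x
  fun f ts [ γ ] = fun f (ts [ γ ]*)
  []       [ γ ]* = []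
  (t ∷ ts) [ γ ]* = (t [ γ ]) ∷ (ts [ γ ]*)

  data Context (ι : Sort) : Sort → Set
  data ArgsContext (ι : Sort) : List Sort → Set

  data Context ι where
    □   : Context ι ι
    fun : ∀ {ιs κ} → Fun ιs κ → ArgsContext ι ιs → Context ι κ

  data ArgsContext ι where
    here  : ∀ {κ κs} → Context ι κ → All Term κs → ArgsContext ι (κ ∷ κs)
    there : ∀ {κ κs} → Term κ → ArgsContext ι κs → ArgsContext ι (κ ∷ κs)

  plug  : ∀ {ι κ} → Context ι κ → Term ι → Term κ
  plug* : ∀ {ι κs} → ArgsContext ι κs → Term ι → All Term κs
  plug □         s = s
  plug (fun f D) s = fun f (plug* D s)
  plug* (here C ts) s = plug C s ∷ ts
  plug* (there t D) s = t ∷ plug* D s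

  data Value : ∀ {κ} → Term κ → Set where
    value : ∀ {κ} {v : Fun [] κ} → IsValue v → Value (fun v [])

  Logical  : ∀ {κ} → Term κ → Set
  Logical* : ∀ {ιs} → All Term ιs → Set
  Logical (var x)    = ⊤
  Logical (fun f ts) = IsTheory f × Logical* ts
  Logical* []        = ⊤
  Logical* (t ∷ ts)  = Logical t × Logical* ts

  GroundLogical  : ∀ {κ} → Term κ → Set
  GroundLogical* : ∀ {ιs} → All Term ιs → Set
  GroundLogical (var x)    = ⊥
  GroundLogical (fun f ts) = IsTheory f × GroundLogical* ts
  GroundLogical* []        = ⊤
  GroundLogical* (t ∷ ts)  = GroundLogical t × GroundLogical* ts

  ⟦_⟧  : ∀ {κ} (s : Term κ) → GroundLogical s → ℐ κ
  ⟦_⟧* : ∀ {ιs} (ts : All Term ιs) → GroundLogical* ts → All ℐ ιs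
  ⟦ fun f ts ⟧ (p , ps) = 𝒥 f p (⟦ ts ⟧* ps)
  ⟦ [] ⟧*     _        = []
  ⟦ t ∷ ts ⟧* (p , ps) = ⟦ t ⟧ p ∷ ⟦ ts ⟧* ps

  _IsValueOf_ : ∀ {κ} → Term κ → Term κ → Set
  t IsValueOf s = Value t ×
    (Σ[ p ∈ GroundLogical s ] Σ[ q ∈ GroundLogical t ] ⟦ s ⟧ p ≡ ⟦ t ⟧ q)

  Valid : Term bool → Set
  Valid φ = ∀ (γ : Subst) → (∀ {ι} {x : Var ι} → x ∈Var φ → Value (γ ι x)) →
    Σ[ p ∈ GroundLogical (φ [ γ ]) ] Inverse.to ℐ-bool (⟦ φ [ γ ] ⟧ p) ≡ true

  record Triple (κ : Sort) : Set where
    constructor _⟶_⟦_⟧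
    field
      lhs rhs    : Term κ
      constraint : Term bool

  open Triple public

  IsRule : ∀ {κ} → Triple κ → Set
  IsRule ρ = Logical (constraint ρ) × ¬ Logical (lhs ρ)

  _∈LVar_ : ∀ {ι κ} → Var ι → Triple κ → Set
  x ∈LVar ρ = x ∈Var constraint ρ ⊎ (x ∈Var rhs ρ × ¬ x ∈Var lhs ρ)

  _Respects_ : ∀ {κ} → Subst → Triple κ → Set
  γ Respects ρ = (∀ {ι} {x : Var ι} → x ∈LVar ρ → Value (γ ι x)) ×
                 Valid (constraint ρ [ γ ])

  _occursIn_ : ∀ {ι κ} → Var ι → Triple κ → Set
  x occursIn ρ = x ∈Var lhs ρ ⊎ x ∈Var rhs ρ ⊎ x ∈Var constraint ρ

  Renaming : Set
  Renaming = ∀ ι → Var ι ↔ Var ι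

  rename : ∀ {κ} → Renaming → Triple κ → Triple κ
  rename π (l ⟶ r ⟦ φ ⟧) = (l [ π̂ ]) ⟶ (r [ π̂ ]) ⟦ φ [ π̂ ] ⟧
    where
    π̂ : Subst
    π̂ ι x = var (Inverse.to (π ι) x)

  _IsCopyOf_ : ∀ {κ} → Triple κ → Triple κ → Set
  ρ′ IsCopyOf ρ = ∃[ π ] ρ′ ≡ rename π ρ

data Length : Set where
  finite : ℕ → Length
  ∞      : Length

Position : Length → Set
Position (finite n) = Fin n
Position ∞          = ℕ

index : ∀ {n} → Position n → ℕ
index {finite n} = toℕ
index {∞}        = id

module Rewriting (S : Setting) (ℛ : ∀ {κ} → Terms.Triple S κ → Set) where
  open Setting S
  open Terms S

  data _→rule_ : ∀ {κ} → Term κ → Term κ → Set where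
    rule : ∀ {ι κ} (C : Context ι κ) {ρ : Triple ι} {γ : Subst} →
           ℛ ρ → γ Respects ρ →
           plug C (lhs ρ [ γ ]) →rule plug C (rhs ρ [ γ ])

  data _→calc_ : ∀ {κ} → Term κ → Term κ → Set where
    calc : ∀ {ιs ι κ} (C : Context ι κ) {f : Fun ιs ι} {ss : All Term ιs} {v : Term ι} →
           IsTheory f → ¬ IsTerms f →
           (∀ {ι′} (i : ι′ ∈ ιs) → Value (lookup ss i)) →
           v IsValueOf fun f ss →
           plug C (fun f ss) →calc plug C v

  _→ℛ_ : ∀ {κ} → Term κ → Term κ → Set
  s →ℛ t = s →rule t ⊎ s →calc t

  _→ℛ*_ : ∀ {κ} → Term κ → Term κ → Set
  _→ℛ*_ = Star _→ℛ_

  Terminating : ∀ {κ} → Term κ → Set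
  Terminating {κ} s =
    ¬ (Σ[ u ∈ (ℕ → Term κ) ] (u 0 ≡ s × (∀ (n : ℕ) → u n →ℛ u (suc n))))

  module _ {κ : Sort} where

    record IsChain (𝒫 : Pred (Triple κ) 0ℓ) {n : Length}
                   (ρ : Position n → Triple κ) : Set where
      field
        copies      : ∀ i → ∃[ ρ₀ ] (𝒫 ρ₀ × ρ i IsCopyOf ρ₀)
        distinct    : ∀ i j → i ≢ j → ∀ {ι} {x : Var ι} →
                      x occursIn ρ i → ¬ x occursIn ρ j
        γ           : Subst
        respects    : ∀ i → γ Respects ρ i
        reduces     : ∀ i j → suc (index {n} i) ≡ index {n} j →
                      (rhs (ρ i) [ γ ]) →ℛ* (lhs (ρ j) [ γ ])
        terminating : ∀ i {ι} {s : Term ι} → s ◁ (lhs (ρ i) [ γ ]) → Terminating s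

    ChainFree : Pred (Triple κ) 0ℓ → Set
    ChainFree 𝒫 = ¬ (∃[ ρ ] IsChain 𝒫 {∞} ρ)

    record IsDependencyGraphApproximation (𝒫 : Pred (Triple κ) 0ℓ)
                                          (G : Rel (Triple κ) 0ℓ) : Set where
      field
        nodes : ∀ {ρ₁ ρ₂} → G ρ₁ ρ₂ → 𝒫 ρ₁ × 𝒫 ρ₂
        edges : ∀ {ρ₁ ρ₂ ρ₂′} → 𝒫 ρ₁ → 𝒫 ρ₂ → ρ₂′ IsCopyOf ρ₂ →
                IsChain 𝒫 {finite 2} (ρ₁ Seq.∷ ρ₂′ Seq.∷ Seq.[]) → G ρ₁ ρ₂

module _ {A : Set} (𝒫 : Pred A 0ℓ) (G : Rel A 0ℓ) where

  StronglyConnected : Pred A 0ℓ → Set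
  StronglyConnected 𝒬 = ∀ {x y} → 𝒬 x → 𝒬 y → Star G x y

  -- Paths of length 0 count, so a single node without a loop may form an SCC.
  record IsSCC (𝒬 : Pred A 0ℓ) : Set₁ where
    field
      nonempty  : Satisfiable 𝒬
      nodes     : 𝒬 ⊆ 𝒫
      connected : StronglyConnected 𝒬
      maximal   : ∀ (𝒬′ : Pred A 0ℓ) → 𝒬′ ⊆ 𝒫 → StronglyConnected 𝒬′ →
                  𝒬 ⊆ 𝒬′ → 𝒬′ ⊆ 𝒬

-- Needed for DP problems: for ℛ = { fᵢ ⟶ fᵢ₊₁ ∣ i ∈ ℕ } the pairs fᵢ♯ ⟶ fᵢ₊₁♯
-- form an infinite chain, but each SCC of the exact graph is a single node
-- without a loop.
Finite : {A : Set} → Pred A 0ℓ → Set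
Finite 𝒫 = ∃[ xs ] (∀ {x} → 𝒫 x → x ∈ xs)

record LCTRS : Set₁ where
  field
    setting : Setting
    ℛ       : ∀ {κ} → Terms.Triple setting κ → Set
    ℛ-rules : ∀ {κ} {ρ : Terms.Triple setting κ} → ℛ ρ → Terms.IsRule setting ρ

module DependencyPairs (L : LCTRS) where
  open LCTRS L
  open Setting setting
  open Terms setting

  Defined : ∀ {ιs κ} → Fun ιs κ → Set
  Defined f = ∃[ ls ] ∃[ r ] ∃[ φ ] ℛ (fun f ls ⟶ r ⟦ φ ⟧)

  data Sort♯ : Set where
    ⌜_⌝    : Sort → Sort♯
    dpsort : Sort♯

  -- The input sorts are constrained by an equation rather than by an index
  -- map ⌜_⌝ ιs, so that one can match on constants.  In sharp the proof of
  -- definedness is irrelevant, so that there is a single symbol f♯ per f.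
  data Fun♯ (ιs♯ : List Sort♯) : Sort♯ → Set where
    base  : ∀ {ιs κ} (f : Fun ιs κ) → ιs♯ ≡ map ⌜_⌝ ιs → Fun♯ ιs♯ ⌜ κ ⌝
    sharp : ∀ {ιs κ} (f : Fun ιs κ) → .(Defined f) → ιs♯ ≡ map ⌜_⌝ ιs → Fun♯ ιs♯ dpsort

  Var♯ : Sort♯ → Set
  Var♯ ⌜ ι ⌝  = Var ι
  Var♯ dpsort = ⊥

  Var♯-infinite : ℕ ↣ ∃ Var♯
  Var♯-infinite = mk↣ {to = embed ∘ Injection.to Var-infinite}
                      (Injection.injective Var-infinite ∘ embed-injective)
    where
    embed : ∃ Var → ∃ Var♯
    embed (ι , x) = ⌜ ι ⌝ , x

    embed-injective : ∀ {x y} → embed x ≡ embed y → x ≡ y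
    embed-injective refl = refl

  IsTerms♯ IsTheory♯ IsValue♯ : ∀ {ιs κ} → Fun♯ ιs κ → Set
  IsTerms♯ (base f _)      = IsTerms f
  IsTerms♯ (sharp f _ _)   = ⊤
  IsTheory♯ (base f _)     = IsTheory f
  IsTheory♯ (sharp f _ _)  = ⊥
  IsValue♯ (base f _)      = IsValue f
  IsValue♯ (sharp f _ _)   = ⊥

  terms∪theory♯ : ∀ {ιs κ} (f : Fun♯ ιs κ) → IsTerms♯ f ⊎ IsTheory♯ f
  terms∪theory♯ (base f _)    = terms∪theory f
  terms∪theory♯ (sharp f _ _) = inj₁ _

  terms∩theory♯ : ∀ {ιs κ} {f : Fun♯ ιs κ} → IsTerms♯ f → IsTheory♯ f → IsValue♯ f
  terms∩theory♯ {f = base f _} = terms∩theory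

  value-constant♯ : ∀ {ιs κ} {f : Fun♯ ιs κ} → IsValue♯ f → ιs ≡ []
  value-constant♯ {f = base f refl} p = cong (map ⌜_⌝) (value-constant p)

  value⇒theory♯ : ∀ {ιs κ} {f : Fun♯ ιs κ} → IsValue♯ f → IsTheory♯ f
  value⇒theory♯ {f = base f _} = value⇒theory

  ℐ♯ : Sort♯ → Set
  ℐ♯ ⌜ ι ⌝  = ℐ ι
  ℐ♯ dpsort = ⊥

  𝒥♯ : ∀ {ιs κ} (f : Fun♯ ιs κ) → .(IsTheory♯ f) → All ℐ♯ ιs → ℐ♯ κ
  𝒥♯ (base f refl) p as = 𝒥 f p (map⁻ as)

  theory-sort : ∀ {ι♯} → OccursIn {Fun = Fun♯} IsTheory♯ ι♯ →
                ∃[ ι ] (ι♯ ≡ ⌜ ι ⌝ × OccursIn {Fun = Fun} IsTheory ι)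
  theory-sort (output {f = base f _} p) = _ , refl , output p
  theory-sort (input {f = base f refl} p i) with ∈-map⁻ ⌜_⌝ i
  ... | ι , j , eq = ι , eq , input p j

  value-unique♯ : ∀ {ι} → OccursIn {Fun = Fun♯} IsTheory♯ ι → (a : ℐ♯ ι) →
    ∃! _≡_ λ (v : Fun♯ [] ι) → Σ[ p ∈ IsValue♯ v ] 𝒥♯ v (value⇒theory♯ {f = v} p) [] ≡ a
  value-unique♯ o a with theory-sort o
  ... | ι , refl , o′ with value-unique o′ a
  ... | v , (p , eq) , unique = base v refl , (p , eq) , unique♯
    where
    unique♯ : ∀ {w : Fun♯ [] ⌜ ι ⌝} →
              Σ[ q ∈ IsValue♯ w ] 𝒥♯ w (value⇒theory♯ {f = w} q) [] ≡ a → base v refl ≡ w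
    unique♯ {base {ιs = []} w refl} q = cong (λ u → base u refl) (unique q)

  bool-theory♯ : OccursIn {Fun = Fun♯} IsTheory♯ ⌜ bool ⌝
  bool-theory♯ with bool-theory
  ... | output {f = f} p  = output {f = base f refl} p
  ... | input {f = f} p i = input {f = base f refl} p (∈-map⁺ ⌜_⌝ i)

  setting♯ : Setting
  setting♯ = record
    { Sort           = Sort♯
    ; Var            = Var♯
    ; Fun            = Fun♯
    ; Var-infinite   = Var♯-infinite
    ; IsTerms        = IsTerms♯
    ; IsTheory       = IsTheory♯
    ; IsValue        = IsValue♯
    ; terms∪theory   = terms∪theory♯
    ; terms∩theory   = λ {_} {_} {f} → terms∩theory♯ {f = f}
    ; value-constant = λ {_} {_} {f} → value-constant♯ {f = f}
    ; value⇒theory   = λ {_} {_} {f} → value⇒theory♯ {f = f}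
    ; ℐ              = ℐ♯
    ; 𝒥              = 𝒥♯
    ; value-unique   = value-unique♯
    ; bool           = ⌜ bool ⌝
    ; bool-theory    = bool-theory♯
    ; ℐ-bool         = ℐ-bool
    }

  module ♯ = Terms setting♯

  ↑  : ∀ {κ} → Term κ → ♯.Term ⌜ κ ⌝
  ↑* : ∀ {ιs} → All Term ιs → All ♯.Term (map ⌜_⌝ ιs)
  ↑ (var x)     = ♯.var x
  ↑ (fun f ts)  = ♯.fun (base f refl) (↑* ts)
  ↑* []         = []
  ↑* (t ∷ ts)   = ↑ t ∷ ↑* ts

  data ℛ♯ : ∀ {κ} → ♯.Triple κ → Set where
    lift : ∀ {κ} {l r : Term κ} {φ : Term bool} →
           ℛ (l ⟶ r ⟦ φ ⟧) → ℛ♯ (↑ l ♯.⟶ ↑ r ⟦ ↑ φ ⟧)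

  fun♯ : ∀ {ιs κ} (f : Fun ιs κ) → .(Defined f) → All Term ιs → ♯.Term dpsort
  fun♯ f d ts = ♯.fun (sharp f d refl) (↑* ts)

  -- The left-hand side of a rule is not a variable, so it is headed by a
  -- symbol, which is defined because of that very rule.
  data IsDependencyPair : ♯.Triple dpsort → Set where
    dp : ∀ {ιs κ ιs′ κ′} {f : Fun ιs κ} {ls : All Term ιs} {r : Term κ} {φ : Term bool}
           {g : Fun ιs′ κ′} {ts : All Term ιs′}
         (ρ : ℛ (fun f ls ⟶ r ⟦ φ ⟧)) → fun g ts ⊴ r → (d : Defined g) →
         IsDependencyPair (fun♯ f (ls , r , φ , ρ) ls ♯.⟶ fun♯ g d ts ⟦ ↑ φ ⟧)

  open Rewriting setting♯ ℛ♯ public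
    using (ChainFree; IsDependencyGraphApproximation)

{-# OPTIONS --safe #-}
-- An infinite chain picks a node of 𝒫 at each position, and consecutive nodes
-- are joined by an edge of G: undoing the renaming of the first of two
-- neighbours turns them into a 2-chain.  As 𝒫 is finite, from some position
-- on only nodes that occur infinitely often are picked; these are mutually
-- reachable, so the rest of the chain lives in one SCC.  Since chain-freeness
-- is a negation, the classical steps, each about finitely many propositions,
-- can be carried out under a double negation.
module Submission where

open import Defs
open import Data.Fin.Base as Fin using (Fin; toℕ)
open import Data.Fin.Properties using (toℕ-injective; sequence)
open import Data.List.Base using (length)
import Data.List.Base as List
open import Data.List.Membership.Propositional using (_∈_)
open import Data.List.Relation.Unary.All using (All; []; _∷_; lookup)
import Data.List.Relation.Unary.Any as Any
open import Data.List.Relation.Unary.Any.Properties using (lookup-index)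
open import Data.Nat.Base using (ℕ; zero; suc; _+_; _≤_; _⊔_; _∸_)
open import Data.Nat.Properties
  using (≤-refl; ≤-trans; m≤m⊔n; m≤n⊔m; m≤n+m; m∸n+n≡m; +-cancelʳ-≡)
open import Data.Product using (∃-syntax; _×_; _,_; proj₁; proj₂)
open import Data.Sum.Base using (inj₁; inj₂)
import Data.Sum.Base as Sum
open import Effect.Monad using (RawMonad)
open import Function.Base using (id; _∘_)
open import Function.Bundles using (_⇔_; mk⇔; Inverse)
open import Function.Construct.Composition using (_↔-∘_)
open import Function.Construct.Symmetry using (↔-sym)
open import Level using (0ℓ)
open import Relation.Binary.Construct.Closure.ReflexiveTransitive using (Star; ε; _◅_; _◅◅_)
open import Relation.Binary.Core using (Rel)
open import Relation.Binary.PropositionalEquality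
  using (_≡_; _≢_; refl; sym; trans; cong; cong₂; subst; subst₂)
open import Relation.Nullary using (¬_; Dec; yes; no; contradiction)
open import Relation.Nullary.Decidable using (decidable-stable; ¬¬-excluded-middle)
open import Relation.Nullary.Negation using (¬¬-Monad)
open import Relation.Unary using (Pred; _⊆_)

-- Substitutions and variable renamings.

module Substitution (S : Setting) where
  open Setting S
  open Terms S

  []-∘  : ∀ {κ} (t : Term κ) (σ τ : Subst) → t [ σ ] [ τ ] ≡ t [ (λ ι x → σ ι x [ τ ]) ]
  []*-∘ : ∀ {ιs} (ts : All Term ιs) (σ τ : Subst) →
          ts [ σ ]* [ τ ]* ≡ ts [ (λ ι x → σ ι x [ τ ]) ]*
  []-∘ (var x)    σ τ = refl
  []-∘ (fun f ts) σ τ = cong (fun f) ([]*-∘ ts σ τ)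
  []*-∘ []       σ τ = refl
  []*-∘ (t ∷ ts) σ τ = cong₂ _∷_ ([]-∘ t σ τ) ([]*-∘ ts σ τ)

  []-cong  : ∀ {κ} (t : Term κ) {σ τ : Subst} → (∀ ι x → σ ι x ≡ τ ι x) → t [ σ ] ≡ t [ τ ]
  []*-cong : ∀ {ιs} (ts : All Term ιs) {σ τ : Subst} →
             (∀ ι x → σ ι x ≡ τ ι x) → ts [ σ ]* ≡ ts [ τ ]*
  []-cong (var x)    eq = eq _ x
  []-cong (fun f ts) eq = cong (fun f) ([]*-cong ts eq)
  []*-cong []       eq = refl
  []*-cong (t ∷ ts) eq = cong₂ _∷_ ([]-cong t eq) ([]*-cong ts eq)

  []-id  : ∀ {κ} (t : Term κ) {σ : Subst} → (∀ ι x → σ ι x ≡ var x) → t [ σ ] ≡ t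
  []*-id : ∀ {ιs} (ts : All Term ιs) {σ : Subst} → (∀ ι x → σ ι x ≡ var x) → ts [ σ ]* ≡ ts
  []-id (var x)    eq = eq _ x
  []-id (fun f ts) eq = cong (fun f) ([]*-id ts eq)
  []*-id []       eq = refl
  []*-id (t ∷ ts) eq = cong₂ _∷_ ([]-id t eq) ([]*-id ts eq)

  ⟨_⟩ : Renaming → Subst
  ⟨ π ⟩ ι x = var (Inverse.to (π ι) x)

  inverse : Renaming → Renaming
  inverse π ι = ↔-sym (π ι)

  _⟫_ : Renaming → Renaming → Renaming
  (π ⟫ θ) ι = θ ι ↔-∘ π ι

  triple-≡ : ∀ {κ} {l l′ r r′ : Term κ} {φ φ′ : Term bool} → l ≡ l′ → r ≡ r′ → φ ≡ φ′ →
             (l ⟶ r ⟦ φ ⟧) ≡ (l′ ⟶ r′ ⟦ φ′ ⟧)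
  triple-≡ refl refl refl = refl

  rename-⟫ : ∀ {κ} (π θ : Renaming) (ρ : Triple κ) →
             rename θ (rename π ρ) ≡ rename (π ⟫ θ) ρ
  rename-⟫ π θ (l ⟶ r ⟦ φ ⟧) = triple-≡ (compose l) (compose r) (compose φ)
    where
    compose : ∀ {κ} (t : Term κ) → t [ ⟨ π ⟩ ] [ ⟨ θ ⟩ ] ≡ t [ ⟨ π ⟫ θ ⟩ ]
    compose t = []-∘ t ⟨ π ⟩ ⟨ θ ⟩

  rename-inverse : ∀ {κ} (π : Renaming) (ρ : Triple κ) → rename (inverse π) (rename π ρ) ≡ ρ
  rename-inverse π (l ⟶ r ⟦ φ ⟧) = triple-≡ (undo l) (undo r) (undo φ)
    where
    undo : ∀ {κ} (t : Term κ) → t [ ⟨ π ⟩ ] [ ⟨ inverse π ⟩ ] ≡ t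
    undo t = trans ([]-∘ t ⟨ π ⟩ ⟨ inverse π ⟩)
                   ([]-id t λ ι x → cong var (Inverse.strictlyInverseʳ (π ι) x))

  module _ (π : Renaming) where

    private
      to from : ∀ {ι} → Var ι → Var ι
      to   {ι} = Inverse.to (π ι)
      from {ι} = Inverse.from (π ι)

    ∈Var-rename⁺  : ∀ {ι κ} {x : Var ι} {t : Term κ} → x ∈Var t → to x ∈Var (t [ ⟨ π ⟩ ])
    ∈Var-rename⁺* : ∀ {ι κ κs} {x : Var ι} (ts : All Term κs) (i : κ ∈ κs) →
                    to x ∈Var (lookup ts i [ ⟨ π ⟩ ]) → to x ∈Var lookup (ts [ ⟨ π ⟩ ]*) i
    ∈Var-rename⁺ here        = here
    ∈Var-rename⁺ (there {ts = ts} i p) = there i (∈Var-rename⁺* ts i (∈Var-rename⁺ p))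
    ∈Var-rename⁺* (t ∷ ts) (Any.here refl) p = p
    ∈Var-rename⁺* (t ∷ ts) (Any.there i)   p = ∈Var-rename⁺* ts i p

    ∈Var-rename⁻  : ∀ {ι κ} {x : Var ι} (t : Term κ) → x ∈Var (t [ ⟨ π ⟩ ]) → from x ∈Var t
    ∈Var-rename⁻* : ∀ {ι κ κs} {x : Var ι} (ts : All Term κs) (i : κ ∈ κs) →
                    x ∈Var lookup (ts [ ⟨ π ⟩ ]*) i → from x ∈Var lookup ts i
    ∈Var-rename⁻ (var y)    here        =
      subst (_∈Var var y) (sym (Inverse.strictlyInverseʳ (π _) y)) here
    ∈Var-rename⁻ (fun f ts) (there i p) = there i (∈Var-rename⁻* ts i p)
    ∈Var-rename⁻* (t ∷ ts) (Any.here refl) p = ∈Var-rename⁻ t p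
    ∈Var-rename⁻* (t ∷ ts) (Any.there i)   p = ∈Var-rename⁻* ts i p

    occursIn-rename⁻ : ∀ {ι κ} {x : Var ι} (ρ : Triple κ) →
                       x occursIn rename π ρ → from x occursIn ρ
    occursIn-rename⁻ ρ = Sum.map (∈Var-rename⁻ (lhs ρ))
                           (Sum.map (∈Var-rename⁻ (rhs ρ)) (∈Var-rename⁻ (constraint ρ)))

    ∈LVar-rename⁻ : ∀ {ι κ} {x : Var ι} (ρ : Triple κ) → x ∈LVar rename π ρ → from x ∈LVar ρ
    ∈LVar-rename⁻ ρ (inj₁ p) = inj₁ (∈Var-rename⁻ (constraint ρ) p)
    ∈LVar-rename⁻ {x = x} ρ (inj₂ (p , ¬q)) = inj₂ (∈Var-rename⁻ (rhs ρ) p ,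
      -- The variables of the left-hand side occur negatively in `∈LVar`, so here a membership must
      -- be pushed forward along `π` rather than pulled back.
      λ q → ¬q (subst (_∈Var (lhs ρ [ ⟨ π ⟩ ])) (Inverse.strictlyInverseˡ (π _) x) (∈Var-rename⁺ q)))

    -- Precomposing with the inverse of `π` makes a renamed term instantiate to exactly what the
    -- original term gives under `γ`, so facts about instances carry over by rewriting alone.
    conjugate : Subst → Subst
    conjugate γ ι x = γ ι (from x)

    []-conjugate : ∀ {κ} (γ : Subst) (t : Term κ) → t [ ⟨ π ⟩ ] [ conjugate γ ] ≡ t [ γ ]
    []-conjugate γ t = trans ([]-∘ t ⟨ π ⟩ (conjugate γ))
                             ([]-cong t λ ι x → cong (γ ι) (Inverse.strictlyInverseʳ (π ι) x))

    Respects-rename : ∀ {κ} {γ : Subst} {ρ : Triple κ} →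
                      γ Respects ρ → conjugate γ Respects rename π ρ
    Respects-rename {γ = γ} {ρ} (values , valid) =
      (λ p → values (∈LVar-rename⁻ ρ p)) ,
      subst Valid (sym ([]-conjugate γ (constraint ρ))) valid

-- Chains: renaming, segments, and edges between neighbours.

index-injective : ∀ {n} {i j : Position n} → index {n} i ≡ index {n} j → i ≡ j
index-injective {finite n} = toℕ-injective
index-injective {∞}        = id

module Chains (S : Setting) (ℛ : ∀ {κ} → Terms.Triple S κ → Set) {κ : Setting.Sort S} where
  open Terms S
  open Substitution S
  open Rewriting S ℛ
  open IsChain

  chain-mono : ∀ {𝒫 𝒬 : Pred (Triple κ) 0ℓ} {n} {ρ : Position n → Triple κ} →
               𝒫 ⊆ 𝒬 → IsChain 𝒫 {n} ρ → IsChain 𝒬 {n} ρ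
  chain-mono 𝒫⊆𝒬 c = record
    { IsChain c
    ; copies = λ i → let ρ₀ , p , eq = copies c i in ρ₀ , 𝒫⊆𝒬 p , eq
    }

  -- All instances stay the same once `γ c` is replaced by its conjugate, and a single bijection
  -- acts on every position, so variables that were disjoint remain so.
  chain-rename : ∀ {𝒫 : Pred (Triple κ) 0ℓ} {n} {ρ : Position n → Triple κ} (θ : Renaming) →
                 IsChain 𝒫 {n} ρ → IsChain 𝒫 {n} (rename θ ∘ ρ)
  chain-rename {n = n} {ρ} θ c = record
    { copies      = λ i → let ρ₀ , p , π , eq = copies c i in
                    ρ₀ , p , (π ⟫ θ) , trans (cong (rename θ) eq) (rename-⟫ π θ ρ₀)
    ; distinct    = λ i j i≢j p q →
                    distinct c i j i≢j (occursIn-rename⁻ θ (ρ i) p) (occursIn-rename⁻ θ (ρ j) q)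
    ; γ           = conjugate θ (γ c)
    ; respects    = λ i → Respects-rename θ (respects c i)
    ; reduces     = λ i j eq → subst₂ _→ℛ*_ (sym ([]-conjugate θ (γ c) (rhs (ρ i))))
                      (sym ([]-conjugate θ (γ c) (lhs (ρ j)))) (reduces c i j eq)
    ; terminating = λ i {_} {s} p →
                    terminating c i (subst (s ◁_) ([]-conjugate θ (γ c) (lhs (ρ i))) p)
    }

  -- Serves twice: with length 2 for two neighbours and with length `∞` for a tail. The entries are
  -- tied to `ρ` by equations because the head of the pair equals an entry of the sequence only
  -- propositionally; `𝒬` is separate from `𝒫` so that a tail can be placed in an SCC.
  chain-segment : ∀ {𝒫 𝒬 : Pred (Triple κ) 0ℓ} {ρ : ℕ → Triple κ}
                  {n} {ρ′ : Position n → Triple κ} (N : ℕ) →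
                  (∀ i → ρ′ i ≡ ρ (index {n} i + N)) →
                  (∀ i → ∃[ ρ₀ ] (𝒬 ρ₀ × ρ (index {n} i + N) IsCopyOf ρ₀)) →
                  IsChain 𝒫 {∞} ρ → IsChain 𝒬 {n} ρ′
  chain-segment {ρ = ρ} {n} {ρ′} N ρ′≡ρ cs c = record
    { copies      = λ i → subst (λ z → ∃[ ρ₀ ] (_ × z IsCopyOf ρ₀)) (sym (ρ′≡ρ i)) (cs i)
    ; distinct    = λ i j i≢j p q → distinct c _ _
                    (i≢j ∘ index-injective ∘ +-cancelʳ-≡ N (index i) (index j))
                    (subst (_ occursIn_) (ρ′≡ρ i) p) (subst (_ occursIn_) (ρ′≡ρ j) q)
    ; γ           = γ c
    ; respects    = λ i → subst (γ c Respects_) (sym (ρ′≡ρ i)) (respects c _)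
    ; reduces     = λ i j eq → subst₂ (λ a b → (rhs a [ γ c ]) →ℛ* (lhs b [ γ c ]))
                      (sym (ρ′≡ρ i)) (sym (ρ′≡ρ j)) (reduces c _ _ (cong (_+ N) eq))
    ; terminating = λ i p →
                    terminating c _ (subst (λ z → _ ◁ (lhs z [ γ c ])) (ρ′≡ρ i) p)
    }

  module _ {𝒫 : Pred (Triple κ) 0ℓ} {ρ : ℕ → Triple κ} (c : IsChain 𝒫 {∞} ρ) where

    original : ℕ → Triple κ
    original i = proj₁ (copies c i)

    original∈ : ∀ i → 𝒫 (original i)
    original∈ i = proj₁ (proj₂ (copies c i))

    -- `edges` wants the first entry to be a node itself and allows only the second to be a copy.
    -- Renaming the whole chain by the inverse of the renaming at `i` restores that node and leaves
    -- its successor a copy.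
    original-edge : ∀ {G} → IsDependencyGraphApproximation 𝒫 G →
                    ∀ i → G (original i) (original (suc i))
    original-edge approx i =
      let ρ₀ , _ , π , eq = copies c i
          θ  = inverse π
          c′ = chain-rename {n = ∞} θ c
      in IsDependencyGraphApproximation.edges approx (original∈ i) (original∈ (suc i))
           (proj₂ (proj₂ (copies c′ (suc i))))
           (chain-segment i
             (λ { Fin.zero           → sym (trans (cong (rename θ) eq) (rename-inverse π ρ₀))
                ; (Fin.suc Fin.zero) → refl })
             (λ j → copies c′ (toℕ j + i)) c′)

-- Strongly connected components as classes of mutual reachability.

module _ {A : Set} (𝒫 : Pred A 0ℓ) (G : Rel A 0ℓ) where

  SCC-of : A → Pred A 0ℓ
  SCC-of a x = 𝒫 x × Star G a x × Star G x a

  SCC-of-isSCC : ∀ {a} → 𝒫 a → IsSCC 𝒫 G (SCC-of a)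
  SCC-of-isSCC {a} p = record
    { nonempty  = a , a∈
    ; nodes     = proj₁
    ; connected = λ (_ , _ , x→a) (_ , a→y , _) → x→a ◅◅ a→y
    -- A strongly connected extension contains `a`, hence joins each of its members to `a` in both
    -- directions.
    ; maximal   = λ 𝒬 𝒬⊆𝒫 connected SCC⊆𝒬 q →
                  𝒬⊆𝒫 q , connected (SCC⊆𝒬 a∈) q , connected q (SCC⊆𝒬 a∈)
    }
    where
    a∈ : SCC-of a a
    a∈ = p , ε , ε

Star-chain : ∀ {A : Set} {G : Rel A 0ℓ} (a : ℕ → A) → (∀ i → G (a i) (a (suc i))) →
             ∀ {i j} → i ≤ j → Star G (a i) (a j)
Star-chain {G = G} a edge {i} {j} i≤j =
  subst (λ k → Star G (a i) (a k)) (m∸n+n≡m i≤j) (go (j ∸ i))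
  where
  go : ∀ d → Star G (a i) (a (d + i))
  go zero    = ε
  go (suc d) = go d ◅◅ (edge (d + i) ◅ ε)

-- Recurrence in finite sets, under double negation.

¬¬-∀Fin : ∀ {n} {P : Fin n → Set} → (∀ i → ¬ ¬ P i) → ¬ ¬ (∀ i → P i)
¬¬-∀Fin = sequence (RawMonad.rawApplicative ¬¬-Monad)

common-bound : ∀ {n} {P : Fin n → ℕ → Set} → (∀ {i a b} → a ≤ b → P i a → P i b) →
               (∀ i → ∃[ b ] P i b) → ∃[ b ] ∀ i → P i b
common-bound {zero}  mono bounds = 0 , λ ()
common-bound {suc n} mono bounds =
  let b , p = bounds Fin.zero
      c , q = common-bound (λ {i} → mono {Fin.suc i}) (bounds ∘ Fin.suc)
  in b ⊔ c , λ { Fin.zero → mono (m≤m⊔n b c) p ; (Fin.suc i) → mono (m≤n⊔m b c) (q i) }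

module _ {n : ℕ} (k : ℕ → Fin n) where

  AbsentFrom : Fin n → ℕ → Set
  AbsentFrom c N = ∀ m → N ≤ m → k m ≢ c

  -- Some values are absent from a certain point on. Beyond a common bound all of these are gone, so
  -- whatever still occurs there occurs again and again.
  eventually-recurrent : ¬ ¬ (∃[ N ] ∀ i → N ≤ i → ∀ M → ¬ AbsentFrom (k i) M)
  eventually-recurrent = λ ¬recurrent →
    ¬¬-∀Fin (λ c → ¬¬-excluded-middle {A = ∃[ N ] AbsentFrom c N}) λ decide →
    -- The bound is conditional so that every value has one: a value that never disappears for good
    -- gets the dummy `0`, and its condition is refuted.
    let bound : ∀ c → ∃[ N ] ((∃[ M ] AbsentFrom c M) → AbsentFrom c N)
        bound c = from-dec (decide c)
        N , absent = common-bound (λ a≤b f x m b≤m → f x m (≤-trans a≤b b≤m)) bound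
    in ¬recurrent (N , λ i N≤i M gone → absent (k i) (M , gone) i N≤i refl)
    where
    from-dec : ∀ {c} → Dec (∃[ N ] AbsentFrom c N) →
               ∃[ N ] ((∃[ M ] AbsentFrom c M) → AbsentFrom c N)
    from-dec (yes (N , gone)) = N , λ _ → gone
    from-dec (no never)       = 0 , λ x → contradiction x never

-- The path itself leads from `a N` to every later node. For the way back from `a i`, follow the
-- path to some index `m` beyond `i` at which the code `k N` recurs; there `a m` is `a N` again.
finite-path-stays-in-SCC : ∀ {A : Set} {𝒫 : Pred A 0ℓ} {G : Rel A 0ℓ} → Finite 𝒫 →
  (a : ℕ → A) → (∀ i → 𝒫 (a i)) → (∀ i → G (a i) (a (suc i))) →
  ¬ ¬ (∃[ N ] ∀ i → SCC-of 𝒫 G (a N) (a (i + N)))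
finite-path-stays-in-SCC {A} {𝒫} {G} (xs , complete) a a∈ edge ¬stays =
  eventually-recurrent k λ (N , recurrent) →
  -- Reachability is decided between codes, of which there are finitely many, rather than between
  -- indices; one double negation then yields `back` at all of the infinitely many `i`.
  ¬¬-∀Fin (λ c → ¬¬-∀Fin λ d → ¬¬-excluded-middle {A = Reach c d}) λ reach? →
  let back : ∀ i → Reach (k i) (k N)
      back i = decidable-stable (reach? (k i) (k N)) λ ¬reach →
        recurrent N ≤-refl i λ m i≤m km≡kN →
        ¬reach (subst (Reach (k i)) km≡kN (subst₂ (Star G) (a≡ i) (a≡ m) (path i≤m)))
  in ¬stays (N , λ i → a∈ _ , path (m≤n+m N i) ,
                       subst₂ (Star G) (sym (a≡ _)) (sym (a≡ N)) (back (i + N)))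
  where
  k : ℕ → Fin (length xs)
  k i = Any.index (complete (a∈ i))

  a≡ : ∀ i → a i ≡ List.lookup xs (k i)
  a≡ i = lookup-index (complete (a∈ i))

  Reach : Rel (Fin (length xs)) 0ℓ
  Reach c d = Star G (List.lookup xs c) (List.lookup xs d)

  path : ∀ {i j} → i ≤ j → Star G (a i) (a j)
  path = Star-chain a edge

theorem5 : (L : LCTRS) →
    let open DependencyPairs L in
    (𝒫 : Pred (♯.Triple dpsort) 0ℓ) →
    𝒫 ⊆ IsDependencyPair →
    Finite 𝒫 →
    (G : Rel (♯.Triple dpsort) 0ℓ) →
    IsDependencyGraphApproximation 𝒫 G →
    ChainFree 𝒫 ⇔ (∀ (𝒫′ : Pred (♯.Triple dpsort) 0ℓ) → IsSCC 𝒫 G 𝒫′ → ChainFree 𝒫′)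
theorem5 L 𝒫 _ finite-𝒫 G approx = mk⇔
  (λ free 𝒫′ scc (ρ , c) → free (ρ , chain-mono {n = ∞} (IsSCC.nodes scc) c))
  λ free (ρ , c) →
    finite-path-stays-in-SCC finite-𝒫 (original c) (original∈ c) (original-edge c approx)
      λ (N , stays) →
        free (SCC-of 𝒫 G (original c N)) (SCC-of-isSCC 𝒫 G (original∈ c N))
          -- The tail from `N` on keeps the substitution of the chain, and each of its entries is a
          -- copy of a node in the component of `original c N`.
          ( (λ i → ρ (i + N))
          , chain-segment {n = ∞} N (λ _ → refl)
              (λ i → original c (i + N) , stays i , proj₂ (proj₂ (copies c (i + N)))) c)
  where
  open DependencyPairs L
  open Chains setting♯ ℛ♯
  open Rewriting.IsChain
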